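{- Let $(\mathcal S,\mathcal T)$ be a medium and let $G=(V,E)$ be a graph representing $(\mathcal S,\mathcal T)$. Then $G$ is mediatic; that is, $G$ is connected, $G$ is bipartite, and the like relation $\mathfrak L$ of $G$ is transitive.
   Context: No set is assumed to be finite. Token systems. Let $\mathcal S$ be a set of states with $|\mathcal S|\ge 2$. A token is a function $\tau:\mathcal S\to\mathcal S$, written $S\mapsto S\tau$, different from the identity function $\tau_0$ on $\mathcal S$; compositions are written $S\tau_1\tau_2\cdots\tau_n=\tau_n[\cdots\tau_2[\tau_1(S)]\cdots]$. A token system is a pair $(\mathcal S,\mathcal T)$ with $\mathcal T\ne\emptyset$ a set of tokens on $\mathcal S$. For distinct states $S,V$, $V$ is adjacent to $S$ if $S\tau=V$ for some $\tau\in\mathcal T$. A token $\tilde\tau\in\mathcal T$ is a reverse of a token $\tau$ if for any two adjacent states $S,V$ (distinct states, one of which is adjacent to the other) we have $S\tau=V\iff V\tilde\tau=S$. A token has at most one reverse. Messages. A message is a string $\boldsymbol m=\tau_1\ldots\tau_n$ of tokens of $\mathcal T$; it defines the function $S\mapsto S\boldsymbol m=S\tau_1\cdots\tau_n$, and produces $V$ from $S$ if $S\boldsymbol m=V$. It is ineffective for $S$ if $S\boldsymbol m=S$; stepwise effective for $S$ if $S\tau_1\cdots\tau_k\ne S\tau_0\cdots\tau_{k-1}$ for $1\le k\le n$; a return (for $S$) if it is both stepwise effective and ineffective for $S$; consistent if it does not contain both a token and its reverse; concise for $S$ if it is consistent, stepwise effective for $S$, and no token occurs in it more than once; vacuous if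 $\{1,\ldots,n\}$ can be partitioned into pairs $\{i,j\}$ such that $\tau_i,\tau_j$ are mutual reverses. A token system $(\mathcal S,\mathcal T)$ is a medium if: [Ma] for any two distinct states $S,V$ there is a concise message producing $V$ from $S$; [Mb] any return message is vacuous. Graphs representing a medium. A graph $(V,E)$ without loops represents the medium $(\mathcal S,\mathcal T)$ if there is a bijection $\gamma:\mathcal S\to V$ such that for all distinct $S,T\in\mathcal S$: $\{\gamma(S),\gamma(T)\}\in E\iff(\exists\tau\in\mathcal T)(S\tau=T)$. Like relation. For a graph $G=(V,E)$ let $\vec E=\{ST\mid\{S,T\}\in E\}$ be the set of its arcs (each edge gives the two arcs $ST$ and $TS$), and let $\delta$ be the graph distance. The like relation $\mathfrak L$ is the relation on $\vec E$ defined, for $\{S,T\},\{P,Q\}\in E$, by $$ST\,\mathfrak L\,PQ\iff \delta(S,P)+1=\delta(T,Q)+1=\delta(S,Q)=\delta(T,P).$$ A graph is mediatic if it is connected, bipartite, and its like relation $\mathfrak L$ is transitive. -}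

module Defs where

open import Data.Bool.Base using (Bool)
open import Data.Fin.Base using (Fin)
open import Data.List.Base using (List; foldl; length; lookup; take)
open import Data.List.Membership.Propositional using () renaming (_∈_ to _∈ˡ_)
open import Data.List.Relation.Unary.All using (All)
import Data.List.Relation.Unary.Unique.Setoid as Unique
open import Data.Nat.Base using (ℕ; zero; suc; _≤_; _<_)
open import Data.Product.Base using (Σ; ∃; ∃-syntax; ∃₂; _×_)
open import Data.Sum.Base using (_⊎_)
open import Function.Base using (id)
open import Function.Bundles using (_⤖_; _⇔_; module Bijection)
open import Level using (Level) renaming (suc to lsuc)
open import Relation.Binary.Core using (Rel)
open import Relation.Binary.Definitions using (Symmetric; Irreflexive; Transitive)
open import Relation.Binary.PropositionalEquality
  using (_≡_; _≢_; _≗_; _→-setoid_)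
open import Relation.Nullary.Negation.Core using (¬_)
open import Relation.Unary using (Pred; _∈_; Satisfiable)

-- A set of tokens is a predicate on functions.  Without function
-- extensionality, two functions count as the same token when they agree
-- pointwise (_≗_).
record TokenSystem (ℓ : Level) : Set (lsuc ℓ) where
  field
    State         : Set ℓ
    𝒯             : Pred (State → State) ℓ
    two-states    : ∃₂ λ (S V : State) → S ≢ V
    𝒯-nonempty    : Satisfiable 𝒯
    𝒯-nonidentity : ∀ {τ} → τ ∈ 𝒯 → ¬ (τ ≗ id)

module _ {ℓ : Level} (M : TokenSystem ℓ) where
  open TokenSystem M

  _AdjacentTo_ : Rel State ℓ
  V AdjacentTo S = S ≢ V × (∃[ τ ] τ ∈ 𝒯 × τ S ≡ V)

  AdjacentStates : Rel State ℓ
  AdjacentStates S V = V AdjacentTo S ⊎ S AdjacentTo V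

  _IsReverseOf_ : Rel (State → State) ℓ
  τ̃ IsReverseOf τ =
    τ̃ ∈ 𝒯 × (∀ {S V} → AdjacentStates S V → (τ S ≡ V) ⇔ (τ̃ V ≡ S))

  MutualReverses : Rel (State → State) ℓ
  MutualReverses τ σ = (σ IsReverseOf τ) × (τ IsReverseOf σ)

  -- Arbitrary strings of functions; a message is one satisfying IsMessage.
  Str : Set ℓ
  Str = List (State → State)

  IsMessage : Pred Str ℓ
  IsMessage = All 𝒯

  -- The leftmost token acts first.
  apply : State → Str → State
  apply = foldl (λ S τ → τ S)

  Ineffective : Str → State → Set ℓ
  Ineffective m S = apply S m ≡ S

  StepwiseEffective : Str → State → Set ℓ
  StepwiseEffective m S =
    ∀ k → k < length m → apply S (take (suc k) m) ≢ apply S (take k m)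

  Return : Str → State → Set ℓ
  Return m S = StepwiseEffective m S × Ineffective m S

  Consistent : Pred Str ℓ
  Consistent m = ∀ {τ σ} → τ ∈ˡ m → σ ∈ˡ m → ¬ (σ IsReverseOf τ)

  NoRepetition : Pred Str ℓ
  NoRepetition = Unique.Unique (State →-setoid State)

  Concise : Str → State → Set ℓ
  Concise m S = Consistent m × StepwiseEffective m S × NoRepetition m

  -- A partition of the positions into pairs is given by the fixed-point-free
  -- involution π exchanging the two members of each pair.
  Vacuous : Pred Str ℓ
  Vacuous m = Σ (Fin (length m) → Fin (length m)) λ π →
    (∀ i → π i ≢ i) ×
    (∀ i → π (π i) ≡ i) ×
    (∀ i → MutualReverses (lookup m i) (lookup m (π i)))

  record IsMedium : Set ℓ where
    field
      Ma : ∀ {S V} → S ≢ V → ∃[ m ] IsMessage m × Concise m S × apply S m ≡ V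
      Mb : ∀ {S m} → IsMessage m → Return m S → Vacuous m

-- Edges {u , v} of a loopless graph, as a symmetric irreflexive relation.
record Graph (ℓ : Level) : Set (lsuc ℓ) where
  field
    Vertex   : Set ℓ
    _~_      : Rel Vertex ℓ
    ~-sym    : Symmetric _~_
    ~-irrefl : Irreflexive _≡_ _~_

Represents : ∀ {ℓ} → Graph ℓ → TokenSystem ℓ → Set ℓ
Represents G M = Σ (State ⤖ Vertex) λ γ →
  let open Bijection γ using () renaming (to to γ⟨_⟩) in
  ∀ {S T} → S ≢ T → (γ⟨ S ⟩ ~ γ⟨ T ⟩) ⇔ (∃[ τ ] τ ∈ 𝒯 × τ S ≡ T)
  where
  open Graph G
  open TokenSystem M

module _ {ℓ : Level} (G : Graph ℓ) where
  open Graph G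

  data Walk : ℕ → Rel Vertex ℓ where
    []  : ∀ {u} → Walk zero u u
    _∷_ : ∀ {n u v w} → u ~ v → Walk n v w → Walk (suc n) u w

  Connected : Set ℓ
  Connected = ∀ u v → ∃[ n ] Walk n u v

  Bipartite : Set ℓ
  Bipartite = Σ (Vertex → Bool) λ side → ∀ {u v} → u ~ v → side u ≢ side v

  -- δ(u , v) = n.  The distance is given by its graph, since a least walk
  -- length cannot be computed in general.
  Distance : Vertex → Vertex → ℕ → Set ℓ
  Distance u v n = Walk n u v × (∀ {m} → Walk m u v → n ≤ m)

  record Arc : Set ℓ where
    field
      source : Vertex
      target : Vertex
      edge   : source ~ target

  -- ST 𝔏 PQ  iff  δ(S,P) + 1 = δ(T,Q) + 1 = δ(S,Q) = δ(T,P)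
  Like : Rel Arc ℓ
  Like ST PQ = ∃[ n ]
    Distance S P n × Distance T Q n × Distance S Q (suc n) × Distance T P (suc n)
    where
    open Arc ST renaming (source to S; target to T)
    open Arc PQ renaming (source to P; target to Q)

  record Mediatic : Set ℓ where
    field
      connected       : Connected
      bipartite       : Bipartite
      like-transitive : Transitive Like

{-# OPTIONS --safe #-}

-- Closed walks are returns, and a vacuous message has even length, so G is
-- bipartite.  Let τ be a token with Sτ ≠ S and Pτ ≠ P.  A concise message from S to P
-- cannot contain the reverse of τ, because the occurrences of a token and of its
-- reverse alternate along an effective message.  Appending τ to it thus gives a
-- consistent message, and consistent messages have minimal length.  Hence
-- δ(S,Pτ) = δ(S,P) + 1, which yields the like relation between the two arcs
-- effected by τ.  Conversely, if ST 𝔏 PQ and Sτ = T, then in the return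
-- S → T ⇝ Q → P ⇝ S the token τ must be paired with the token taking Q to P:
-- otherwise the like relation between two arcs effected by τ would shorten a
-- geodesic.  So 𝔏 holds exactly between arcs effected by the same token.
module Submission where

open import Defs
open import Axiom.ExcludedMiddle using (ExcludedMiddle)
import Algebra.Properties.CommutativeMonoid.Sum
open import Data.Bool.Base using (Bool; true; false; not; _xor_)
open import Data.Bool.Properties using (xor-same; not-distribˡ-xor)
open import Data.Fin.Base using (Fin; zero; suc)
open import Data.Fin.Permutation using (permutation)
open import Data.Fin.Properties using (injective⇒≤; <-cmp) renaming (_<?_ to _<ᶠ?_)
open import Data.List.Base using (List; []; _∷_; _++_; length; lookup)
open import Data.List.Properties using (length-++)
open import Data.List.Membership.Propositional using () renaming (_∈_ to _∈ˡ_)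
open import Data.List.Membership.Propositional.Properties
  using (∈-lookup; ∈-∃++; ∈-++⁻; ∈-++⁺ˡ; ∈-insert)
open import Data.List.Relation.Unary.All as All using (All; []; _∷_)
open import Data.List.Relation.Unary.AllPairs using ([]; _∷_)
open import Data.List.Relation.Unary.Any using (here)
import Data.List.Relation.Unary.Unique.Setoid as Unique
open import Data.Nat.Base using (ℕ; zero; suc; _+_; _≤_; _<_; z≤n; s≤s)
open import Data.Nat.Properties
  using (≤-trans; ≤-antisym; ≤-reflexive; 1+n≰n; n≤1+n; suc-injective; +-suc; +-comm;
         +-monoʳ-≤; +-monoˡ-≤; +-0-commutativeMonoid; module ≤-Reasoning)
open import Data.Product.Base using (∃-syntax; ∃₂; _×_; _,_; proj₁; proj₂)
open import Data.Sum.Base using (_⊎_; inj₁; inj₂; [_,_]; swap; map₁)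
open import Data.Sum.Properties using (inj₁-injective)
open import Function.Base using (_∘_)
open import Function.Bundles using (mk⇔; module Equivalence; module Bijection)
open import Relation.Binary.Bundles using (Setoid)
open import Relation.Binary.Definitions using (tri<; tri≈; tri>; Transitive)
open import Relation.Binary.PropositionalEquality
  using (_≡_; _≢_; _≗_; refl; sym; trans; cong; subst; subst₂; _→-setoid_; module ≡-Reasoning)
open import Relation.Unary using (_∈_)
open import Relation.Nullary using (¬_; yes; no; contradiction)

open Algebra.Properties.CommutativeMonoid.Sum +-0-commutativeMonoid
  using (sum; sum-cong-≗; sum-permute; ∑-distrib-+)

-- Parity of a finite set with a fixed-point-free involution

odd : ℕ → Bool
odd zero    = false
odd (suc n) = not (odd n)

odd-+ : ∀ m n → odd (m + n) ≡ odd m xor odd n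
odd-+ zero    n = refl
odd-+ (suc m) n = trans (cong not (odd-+ m n)) (not-distribˡ-xor (odd m) (odd n))

odd-double : ∀ n → odd (n + n) ≡ false
odd-double n = trans (odd-+ n n) (xor-same (odd n))

sum-ones : ∀ n → sum {n} (λ _ → 1) ≡ n
sum-ones zero    = refl
sum-ones (suc n) = cong suc (sum-ones n)

-- Each `i` satisfies exactly one of `i < π i` and `π i < i`. As `π` exchanges the two kinds of
-- position, they are equally many.
fixed-point-free-involution⇒even : ∀ {n} (π : Fin n → Fin n) →
  (∀ i → π i ≢ i) → (∀ i → π (π i) ≡ i) → odd n ≡ false
fixed-point-free-involution⇒even {n} π fpf inv =
  trans (cong odd n≡sum+sum) (odd-double (sum below))
  where
  less : Fin n → Fin n → ℕ
  less i j with i <ᶠ? j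
  ... | yes _ = 1
  ... | no  _ = 0

  below above : Fin n → ℕ
  below i = less i (π i)
  above i = less (π i) i

  one : ∀ i → 1 ≡ below i + above i
  one i with i <ᶠ? π i | π i <ᶠ? i | <-cmp i (π i)
  ... | yes p | yes q | tri< _ _ ¬q = contradiction q ¬q
  ... | yes p | yes q | tri≈ ¬p _ _ = contradiction p ¬p
  ... | yes p | yes q | tri> ¬p _ _ = contradiction p ¬p
  ... | yes _ | no  _ | _           = refl
  ... | no  _ | yes _ | _           = refl
  ... | no ¬p | no ¬q | tri< p _ _  = contradiction p ¬p
  ... | no ¬p | no ¬q | tri≈ _ e _  = contradiction (sym e) (fpf i)
  ... | no ¬p | no ¬q | tri> _ _ q  = contradiction q ¬q

  sum-below≡sum-above : sum below ≡ sum above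
  sum-below≡sum-above = trans
    (sum-permute below (permutation π π inv inv))
    (sum-cong-≗ λ i → cong (less (π i)) (inv i))

  n≡sum+sum : n ≡ sum below + sum below
  n≡sum+sum = begin
    n                             ≡⟨ sum-ones n ⟨
    sum {n} (λ _ → 1)             ≡⟨ sum-cong-≗ one ⟩
    sum (λ i → below i + above i) ≡⟨ ∑-distrib-+ below above ⟩
    sum below + sum above         ≡⟨ cong (sum below +_) sum-below≡sum-above ⟨
    sum below + sum below         ∎
    where open ≡-Reasoning

-- Positions in lists

module _ {a} {A : Set a} where

  splitPosition : ∀ (xs {ys} : List A) →
    Fin (length (xs ++ ys)) → Fin (length xs) ⊎ Fin (length ys)
  splitPosition []       i       = inj₂ i
  splitPosition (x ∷ xs) zero    = inj₁ zero
  splitPosition (x ∷ xs) (suc i) = map₁ suc (splitPosition xs i)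

  joinPosition : ∀ (xs {ys} : List A) →
    Fin (length xs) ⊎ Fin (length ys) → Fin (length (xs ++ ys))
  joinPosition []       (inj₂ j)       = j
  joinPosition (x ∷ xs) (inj₁ zero)    = zero
  joinPosition (x ∷ xs) (inj₁ (suc i)) = suc (joinPosition xs (inj₁ i))
  joinPosition (x ∷ xs) (inj₂ j)       = suc (joinPosition xs (inj₂ j))

  split-join : ∀ (xs {ys} : List A) k → splitPosition xs {ys} (joinPosition xs k) ≡ k
  split-join []       (inj₂ j)       = refl
  split-join (x ∷ xs) (inj₁ zero)    = refl
  split-join (x ∷ xs) (inj₁ (suc i)) = cong (map₁ suc) (split-join xs (inj₁ i))
  split-join (x ∷ xs) (inj₂ j)       = cong (map₁ suc) (split-join xs (inj₂ j))

  join-split : ∀ (xs {ys} : List A) i → joinPosition xs {ys} (splitPosition xs i) ≡ i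
  join-split []       i       = refl
  join-split (x ∷ xs) zero    = refl
  join-split (x ∷ xs) (suc i) with splitPosition xs i | join-split xs i
  ... | inj₁ _ | refl = refl
  ... | inj₂ _ | refl = refl

  lookup-join : ∀ (xs {ys} : List A) k →
    lookup (xs ++ ys) (joinPosition xs k) ≡ [ lookup xs , lookup ys ] k
  lookup-join []       (inj₂ j)       = refl
  lookup-join (x ∷ xs) (inj₁ zero)    = refl
  lookup-join (x ∷ xs) (inj₁ (suc i)) = lookup-join xs (inj₁ i)
  lookup-join (x ∷ xs) (inj₂ j)       = lookup-join xs (inj₂ j)

module _ {a r} (A : Setoid a r) where
  open Setoid A using (Carrier; _≈_) renaming (sym to ≈-sym)

  Unique⇒lookup-injective : ∀ {xs} → Unique.Unique A xs →
    ∀ i j → lookup xs i ≈ lookup xs j → i ≡ j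
  Unique⇒lookup-injective (_ ∷ _)  zero    zero    _ = refl
  Unique⇒lookup-injective (x≉ ∷ _) zero    (suc j) e =
    contradiction e (All.lookup x≉ (∈-lookup j))
  Unique⇒lookup-injective (x≉ ∷ _) (suc i) zero    e =
    contradiction (≈-sym e) (All.lookup x≉ (∈-lookup i))
  Unique⇒lookup-injective (_ ∷ u)  (suc i) (suc j) e =
    cong suc (Unique⇒lookup-injective u i j e)

-- Effective messages and returns

module Medium {ℓ} (em : ExcludedMiddle ℓ) (M : TokenSystem ℓ) (isMedium : IsMedium M) where
  open TokenSystem M
  open IsMedium isMedium

  infix 4 _reverses_

  Token : Set ℓ
  Token = State → State

  _reverses_ : Token → Token → Set ℓ
  σ reverses τ = _IsReverseOf_ M σ τ

  -- A stepwise effective message together with the state it produces, in inductive form, so that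
  -- concatenating and cutting messages are structural recursions.
  data Effective : State → List Token → State → Set ℓ where
    []  : ∀ {S} → Effective S [] S
    _∷_ : ∀ {S τ m V} → τ ∈ 𝒯 × τ S ≢ S → Effective (τ S) m V → Effective S (τ ∷ m) V

  private variable
    S T V P Q X : State
    τ σ ρ       : Token
    m m′        : List Token
    n n′        : ℕ

  infixr 5 _++ᵉ_
  _++ᵉ_ : Effective S m V → Effective V m′ P → Effective S (m ++ m′) P
  []      ++ᵉ f = f
  (s ∷ e) ++ᵉ f = s ∷ (e ++ᵉ f)

  splitᵉ : ∀ m → Effective S (m ++ m′) V → ∃[ X ] Effective S m X × Effective X m′ V
  splitᵉ []      e       = _ , [] , e
  splitᵉ (τ ∷ m) (s ∷ e) = let X , f , g = splitᵉ m e in X , s ∷ f , g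

  effective⇒message : Effective S m V → IsMessage M m
  effective⇒message []            = []
  effective⇒message ((t , _) ∷ e) = t ∷ effective⇒message e

  effective⇒stepwise : Effective S m V → StepwiseEffective M m S
  effective⇒stepwise ((_ , s) ∷ e) zero    _         = s
  effective⇒stepwise (_ ∷ e)       (suc k) (s≤s k<n) = effective⇒stepwise e k k<n

  effective⇒apply : Effective S m V → apply M S m ≡ V
  effective⇒apply []      = refl
  effective⇒apply (_ ∷ e) = effective⇒apply e

  stepwise⇒effective : IsMessage M m → StepwiseEffective M m S →
    Effective S m (apply M S m)
  stepwise⇒effective []       _  = []
  stepwise⇒effective (t ∷ ts) se =
    (t , se 0 (s≤s z≤n)) ∷ stepwise⇒effective ts (λ k k<n → se (suc k) (s≤s k<n))

  concise-message : ∀ S V →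
    ∃[ m ] Effective S m V × Consistent M m × NoRepetition M m
  concise-message S V with em {S ≡ V}
  ... | yes refl = [] , [] , (λ ()) , []
  ... | no S≢V with m , ts , (c , se , u) , refl ← Ma S≢V =
    m , stepwise⇒effective ts se , c , u

  return-vacuous : Effective S m S → Vacuous M m
  return-vacuous e =
    Mb (effective⇒message e) (effective⇒stepwise e , effective⇒apply e)

  return-even : Effective S m S → odd (length m) ≡ false
  return-even e = let π , fpf , inv , _ = return-vacuous e in
    fixed-point-free-involution⇒even π fpf inv

  -- Vacuity over an arbitrary index type. With `I` the disjoint sum of the positions in two
  -- consecutive pieces of a return, matching on `partner i` tells which piece the partner lies in.
  record Pairing {I : Set} (f : I → Token) : Set ℓ where
    field
      partner          : I → I
      partner-≢        : ∀ i → partner i ≢ i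
      partner-inv      : ∀ i → partner (partner i) ≡ i
      partner-reverses : ∀ i → f (partner i) reverses f i

    partner-injective : ∀ {i j} → partner i ≡ partner j → i ≡ j
    partner-injective {i} {j} e =
      trans (sym (partner-inv i)) (trans (cong partner e) (partner-inv j))

  return-pairing : ∀ m {m′} → Effective S m V → Effective V m′ S →
    Pairing [ lookup m , lookup m′ ]
  return-pairing m {m′} e e′ = let π , fpf , inv , rev = return-vacuous (e ++ᵉ e′) in record
    { partner          = splitPosition m ∘ π ∘ joinPosition m
    ; partner-≢        = λ k eq → fpf (joinPosition m k)
        (trans (sym (join-split m _)) (cong (joinPosition m) eq))
    ; partner-inv      = λ k → trans
        (cong (splitPosition m) (trans (cong π (join-split m _)) (inv _)))
        (split-join m k)
    ; partner-reverses = λ k → let i = joinPosition m k in subst₂ _reverses_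
        (trans (cong (lookup (m ++ m′)) (sym (join-split m (π i))))
               (lookup-join m (splitPosition m (π i))))
        (lookup-join m k)
        (proj₁ (rev i))
    }

  -- Reverses of tokens

  reverses-sym : τ ∈ 𝒯 → σ reverses τ → τ reverses σ
  reverses-sym t (_ , r) = t , λ adj → let open Equivalence (r (swap adj)) in mk⇔ from to

  reverse-step : τ ∈ 𝒯 → τ S ≢ S → σ reverses τ → σ (τ S) ≡ S
  reverse-step t s (_ , r) =
    Equivalence.to (r (inj₁ (s ∘ sym , _ , t , refl))) refl

  reverse-agree : σ reverses τ → ρ reverses τ → σ V ≢ V → ρ V ≡ σ V
  reverse-agree (t , r) (_ , r′) s =
    let adj = inj₂ (s ∘ sym , _ , t , refl) in
    Equivalence.to (r′ adj) (Equivalence.from (r adj) refl)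

  -- At a state moved by one of the two reverses, the other agrees with it by `reverse-agree`; at
  -- any other state both act as the identity.
  reverse-unique : σ reverses τ → ρ reverses τ → σ ≗ ρ
  reverse-unique {σ} {τ} {ρ} r r′ V with em {σ V ≡ V} | em {ρ V ≡ V}
  ... | no s  | _      = sym (reverse-agree r r′ s)
  ... | yes _ | no s   = reverse-agree r′ r s
  ... | yes p | yes q  = trans p (sym q)

  reverses-cong : σ ≗ τ → σ ∈ 𝒯 → τ reverses τ → σ reverses σ
  reverses-cong σ≗τ t (_ , r) = t , λ {S} {V} adj →
    let open Equivalence (r adj) in mk⇔
      (λ e → trans (σ≗τ V) (to (trans (sym (σ≗τ S)) e)))
      (λ e → trans (σ≗τ S) (from (trans (sym (σ≗τ V)) e)))

  -- `τ` followed by a concise message from `τ S` back to `S` is a return, and the partner of the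
  -- initial `τ` must lie in the concise message.
  reverse-in-concise : τ ∈ 𝒯 → τ S ≢ S →
    ∃₂ λ m σ → Consistent M m × σ ∈ˡ m × σ reverses τ
  reverse-in-concise {τ} {S} t s with m , e , c , _ ← concise-message (τ S) S
    with return-pairing (τ ∷ []) ((t , s) ∷ []) e
  ... | p with Pairing.partner p (inj₁ zero) in eq | Pairing.partner-reverses p (inj₁ zero)
  ... | inj₁ zero | _ = contradiction eq (Pairing.partner-≢ p (inj₁ zero))
  ... | inj₂ j    | r = m , lookup m j , c , ∈-lookup j , r

  -- Otherwise the reverse `σ` found in a concise message would agree with `τ` and so be its own
  -- reverse, and `σ` taken twice would violate consistency.
  not-self-reverse : τ ∈ 𝒯 → τ S ≢ S → ¬ (τ reverses τ)
  not-self-reverse t s self =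
    let m , σ , c , σ∈m , r = reverse-in-concise t s in
    c σ∈m σ∈m (reverses-cong (reverse-unique r self) (proj₁ r) self)

  reverse-exists : τ ∈ 𝒯 → τ S ≢ S → ∃[ σ ] σ reverses τ
  reverse-exists t s = let _ , σ , _ , _ , r = reverse-in-concise t s in σ , r

  -- Closing up τ m τ by a concise message m′ gives a return.  As m′ contains at
  -- most one reverse of τ, the reverse paired with one of the two τ lies in m.
  alternation : τ ∈ 𝒯 → τ S ≢ S → Effective (τ S) m P → τ P ≢ P →
    ∃[ ρ ] ρ ∈ˡ m × ρ reverses τ
  alternation {τ} {S} {m} {P} t s e s′
    with m′ , e′ , _ , u ← concise-message (τ P) S
    with return-pairing (τ ∷ m) ((t , s) ∷ e) ((t , s′) ∷ e′)
  ... | p with Pairing.partner p (inj₁ zero) in eq₁ | Pairing.partner p (inj₂ zero) in eq₂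
             | Pairing.partner-reverses p (inj₁ zero) | Pairing.partner-reverses p (inj₂ zero)
  ... | inj₁ zero    | _            | r | _ = contradiction r (not-self-reverse t s)
  ... | inj₂ zero    | _            | r | _ = contradiction r (not-self-reverse t s)
  ... | inj₁ (suc i) | _            | r | _ = lookup m i , ∈-lookup i , r
  ... | inj₂ (suc j) | inj₁ zero    | _ | r = contradiction r (not-self-reverse t s)
  ... | inj₂ (suc j) | inj₂ zero    | _ | r = contradiction r (not-self-reverse t s)
  ... | inj₂ (suc j) | inj₁ (suc i) | _ | r = lookup m i , ∈-lookup i , r
  ... | inj₂ (suc j) | inj₂ (suc k) | r | r′
    with refl ← Unique⇒lookup-injective (State →-setoid State) u j k (reverse-unique r r′)
    with () ← Pairing.partner-injective p (trans eq₁ (sym eq₂))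

  -- Minimal messages and distances between states

  reversal : Effective S m V → ∃[ m′ ] Effective V m′ S × length m′ ≡ length m
  reversal [] = [] , [] , refl
  reversal {S} (_∷_ {τ = τ} {m = m} (t , s) e) =
    let σ , r       = reverse-exists t s
        m′ , e′ , l = reversal e
        back        = reverse-step t s r
    in m′ ++ σ ∷ []
     , e′ ++ᵉ subst (Effective (τ S) (σ ∷ [])) back
         ((proj₁ r , λ q → s (trans (sym q) back)) ∷ [])
     , trans (length-++ m′) (trans (+-comm _ 1) (cong suc l))

  -- In the return `m ++ m′` no two positions of the consistent `m` can be partners, so `partner`
  -- injects the positions of `m` into those of `m′`.
  consistent-minimal : Consistent M m → Effective S m V → Effective V m′ S →
    length m ≤ length m′
  consistent-minimal {m} {m′ = m′} c e e′ = injective⇒≤ {f = proj₁ ∘ opposite} λ {i} {j} eq →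
    inj₁-injective (partner-injective (trans (proj₂ (opposite i))
      (trans (cong inj₂ eq) (sym (proj₂ (opposite j))))))
    where
    open Pairing (return-pairing m e e′)

    opposite : ∀ i → ∃[ j ] partner (inj₁ i) ≡ inj₂ j
    opposite i with partner (inj₁ i) | partner-reverses (inj₁ i)
    ... | inj₁ k | r = contradiction r (c (∈-lookup i) (∈-lookup k))
    ... | inj₂ j | _ = j , refl

  -- The counterpart of `Distance` for states: effective messages take the place of walks.
  δ : State → State → ℕ → Set ℓ
  δ S V n = (∃[ m ] Effective S m V × length m ≡ n) ×
            (∀ {m} → Effective S m V → n ≤ length m)

  δ-unique : δ S V n → δ S V n′ → n ≡ n′
  δ-unique ((_ , e , refl) , min) ((_ , e′ , refl) , min′) = ≤-antisym (min e′) (min′ e)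

  δ-sym : δ S V n → δ V S n
  δ-sym ((_ , e , refl) , min) = reversal e , λ f →
    let _ , f′ , l = reversal f in ≤-trans (min f′) (≤-reflexive l)

  δ-consistent : Consistent M m → Effective S m V → δ S V (length m)
  δ-consistent c e = (_ , e , refl) , λ f →
    let _ , f′ , l = reversal f in ≤-trans (consistent-minimal c e f′) (≤-reflexive l)

  δ-exists : ∀ S V → ∃[ n ] δ S V n
  δ-exists S V = let m , e , c , _ = concise-message S V in length m , δ-consistent c e

  -- If `m` is `a ++ ρ ∷ b`, then `ρ`, `a`, `ρ` act effectively in turn from `τ S`, the first `ρ`
  -- leading back to `S`. By `alternation` a reverse of `ρ` lies in `a`, against the consistency of
  -- `m`.
  reverse-∉-consistent : τ ∈ 𝒯 → τ S ≢ S → Consistent M m → Effective S m P →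
    ρ ∈ˡ m → ¬ (ρ reverses τ)
  reverse-∉-consistent {τ} {S} {ρ = ρ} t s c e ρ∈m r with a , b , refl ← ∈-∃++ ρ∈m
    with X , e₁ , ((_ , s′) ∷ _) ← splitᵉ a e =
    let back         = reverse-step t s r
        σ , σ∈a , r′ = alternation (proj₁ r) (λ q → s (trans (sym q) back))
                         (subst (λ Y → Effective Y a X) (sym back) e₁) s′
    in c ρ∈m (∈-++⁺ˡ σ∈a) r′

  δ-step : τ ∈ 𝒯 → τ S ≢ S → τ P ≢ P → δ S P n → δ S (τ P) (suc n)
  δ-step {τ} {S} {P} t s s′ d with m , e , c , _ ← concise-message S P
    with refl ← δ-unique d (δ-consistent c e) =
    subst (δ S (τ P)) (trans (length-++ m) (+-comm _ 1))
      (δ-consistent consistent (e ++ᵉ ((t , s′) ∷ [])))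
    where
    consistent : Consistent M (m ++ τ ∷ [])
    consistent ρ∈ σ∈ r with ∈-++⁻ m ρ∈ | ∈-++⁻ m σ∈
    ... | inj₁ ρ∈m         | inj₁ σ∈m         = c ρ∈m σ∈m r
    ... | inj₁ ρ∈m         | inj₂ (here refl) =
      reverse-∉-consistent t s c e ρ∈m
        (reverses-sym (All.lookup (effective⇒message e) ρ∈m) r)
    ... | inj₂ (here refl) | inj₁ σ∈m         = reverse-∉-consistent t s c e σ∈m r
    ... | inj₂ (here refl) | inj₂ (here refl) = not-self-reverse t s r

  δ-step-source : τ ∈ 𝒯 → τ S ≢ S → τ P ≢ P → δ S P n → δ (τ S) P (suc n)
  δ-step-source t s s′ d = δ-sym (δ-step t s′ s (δ-sym d))

  -- Let `k` be the distance from `τ S` to `τ P`. The distance from `τ S` to `P` is `suc k` by a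
  -- step of the reverse `σ` at `τ P`, and `suc n` by a step of `τ` at `S`.
  δ-parallel : τ ∈ 𝒯 → τ S ≢ S → τ P ≢ P → δ S P n → δ (τ S) (τ P) n
  δ-parallel {τ} {S} {P} t s s′ d
    with σ , r ← reverse-exists t s
    with k , d′ ← δ-exists (τ S) (τ P) = subst (δ (τ S) (τ P)) k≡n d′
    where
    back : ∀ {X} → τ X ≢ X → σ (τ X) ≡ X
    back s = reverse-step t s r

    σ-moves : ∀ {X} → τ X ≢ X → σ (τ X) ≢ τ X
    σ-moves s q = s (trans (sym q) (back s))

    k≡n = suc-injective (δ-unique
      (subst (λ Y → δ (τ S) Y (suc k)) (back s′)
        (δ-step (proj₁ r) (σ-moves s) (σ-moves s′) d′))
      (δ-step-source t s s′ d))

  -- The part of the message between τ and its reverse ρ joins two arcs effected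
  -- by τ, so translating it across them saves both steps.
  shortcut : τ ∈ 𝒯 → τ S ≢ S → Effective (τ S) m V → ρ ∈ˡ m → ρ reverses τ →
    ∃[ m′ ] Effective S m′ V × length m′ < length m
  shortcut {τ} {S} t s e ρ∈m r
    with a , b , refl ← ∈-∃++ ρ∈m
    with X , e₁ , (_∷_ {τ = ρ} (_ , s′) e₂) ← splitᵉ a e
    with r′ ← reverses-sym t r
    with back ← reverse-step (proj₁ r) s′ r′
    with k , d ← δ-exists S (ρ X)
    with (m′ , f , refl) , _ ← d
    with _ , min ← δ-parallel t s (λ q → s′ (trans (sym q) back)) d =
    m′ ++ b , f ++ᵉ e₂ , (begin
      suc (length (m′ ++ b))         ≡⟨ cong suc (length-++ m′) ⟩
      suc (length m′ + length b)     ≤⟨ s≤s (+-monoˡ-≤ (length b)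
                                          (min (subst (Effective (τ S) a) (sym back) e₁))) ⟩
      suc (length a + length b)      ≡⟨ +-suc (length a) (length b) ⟨
      length a + length (ρ ∷ b)      ≡⟨ length-++ a ⟨
      length (a ++ ρ ∷ b)            ∎)
    where open ≤-Reasoning

  -- Like arcs and the tokens effecting them

  token-like : τ ∈ 𝒯 → τ S ≢ S → τ X ≢ X →
    ∃[ n ] δ S X n × δ (τ S) (τ X) n × δ S (τ X) (suc n) × δ (τ S) X (suc n)
  token-like {S = S} {X = X} t s s′ = let n , d = δ-exists S X in
    n , d , δ-parallel t s s′ d , δ-step t s s′ d , δ-step-source t s s′ d

  -- The arcs are ST and PQ with T = `τ S` and P = `σ Q`. The second is traversed from Q to P, as
  -- the return S → T ⇝ Q → P ⇝ S requires.
  like-token : τ ∈ 𝒯 → τ S ≢ S → σ ∈ 𝒯 → σ Q ≢ Q →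
    δ S (σ Q) n → δ (τ S) Q n → δ S Q (suc n) → δ (τ S) (σ Q) (suc n) →
    τ (σ Q) ≡ Q
  like-token {τ} {S} {σ} {Q} t s t′ s′ dSP ((m , e , l) , _) (_ , minSQ) dTP
    with (m′ , e′ , l′) , _ ← δ-sym dSP
    with return-pairing (τ ∷ m) ((t , s) ∷ e) ((t′ , s′) ∷ e′)
  ... | p with Pairing.partner p (inj₁ zero) in eq | Pairing.partner-reverses p (inj₁ zero)
  ... | inj₁ zero    | r = contradiction r (not-self-reverse t s)
  ... | inj₂ zero    | r = reverse-step t′ s′ (reverses-sym t r)
  -- A reverse of `τ` on the geodesic from T to Q yields a message from S to Q of length below `n`,
  -- but their distance is `suc n`.
  ... | inj₁ (suc i) | r =
    let _ , f , f<m = shortcut t s e (∈-lookup i) r in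
    contradiction (≤-trans (s≤s (minSQ f)) (≤-trans f<m (≤-trans (≤-reflexive l) (n≤1+n _)))) 1+n≰n
  -- Here a reverse of `τ` lies on the geodesic from P to S. Once `τ` is appended, the tail from
  -- that reverse on ends with its own reverse and can be shortcut. This joins P to T in at most `n`
  -- steps, but their distance is `suc n`.
  ... | inj₂ (suc j) | r
    with a , b , eq ← ∈-∃++ (∈-lookup {xs = m′} j)
    with X , e₁ , ((t″ , s″) ∷ e₂) ← splitᵉ a (subst (λ x → Effective _ x S) eq e′) =
    let f , g , f<b = shortcut t″ s″ (e₂ ++ᵉ ((t , s) ∷ [])) (∈-insert b) (reverses-sym t r)
        _ , h , k   = reversal (e₁ ++ᵉ g)
    in contradiction
      (≤-trans (proj₂ dTP h) (≤-trans (≤-reflexive k)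
        (≤-trans (shorter a b f f<b) (≤-reflexive (trans (cong length (sym eq)) l′)))))
      1+n≰n
    where
    shorter : ∀ {ρ} a b f → length f < length (b ++ τ ∷ []) →
      length (a ++ f) ≤ length (a ++ ρ ∷ b)
    shorter {ρ} a b f f<b = begin
      length (a ++ f)                 ≡⟨ length-++ a ⟩
      length a + length f             ≤⟨ +-monoʳ-≤ (length a) (≤-trans (n≤1+n _) f<b) ⟩
      length a + length (b ++ τ ∷ []) ≡⟨ cong (length a +_) (trans (length-++ b) (+-comm _ 1)) ⟩
      length a + length (ρ ∷ b)       ≡⟨ length-++ a ⟨
      length (a ++ ρ ∷ b)             ∎
      where open ≤-Reasoning

-- Transfer to the representing graph

module Representation {ℓ} (em : ExcludedMiddle ℓ) (M : TokenSystem ℓ) (isMedium : IsMedium M)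
  (G : Graph ℓ) (represents : Represents G M) where
  open TokenSystem M
  open Graph G
  open Medium em M isMedium
  open Bijection (proj₁ represents) using (injective; strictlySurjective)
    renaming (to to γ)

  edge⇒token : ∀ {S T} → γ S ~ γ T → ∃[ τ ] (τ ∈ 𝒯 × τ S ≢ S) × τ S ≡ T
  edge⇒token {S} {T} e =
    let S≢T         = λ eq → ~-irrefl (cong γ eq) e
        τ , t , τS≡T = Equivalence.to (proj₂ represents S≢T) e
    in τ , (t , λ q → S≢T (trans (sym q) τS≡T)) , τS≡T

  token⇒edge : ∀ {τ S} → τ ∈ 𝒯 → τ S ≢ S → γ S ~ γ (τ S)
  token⇒edge t s = Equivalence.from (proj₂ represents (s ∘ sym)) (_ , t , refl)

  message⇒walk : ∀ {S m V} → Effective S m V → Walk G (length m) (γ S) (γ V)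
  message⇒walk []            = []
  message⇒walk ((t , s) ∷ e) = token⇒edge t s ∷ message⇒walk e

  -- The endpoints are variables tied to `γ S` and `γ V` by equations, because matching on a walk
  -- cannot unify indices of the form `γ S`.
  walk⇒message′ : ∀ {n u v S V} → γ S ≡ u → γ V ≡ v → Walk G n u v →
    ∃[ m ] Effective S m V × length m ≡ n
  walk⇒message′ {S = S} p q [] with refl ← injective (trans p (sym q)) = [] , [] , refl
  walk⇒message′ refl q (_∷_ {v = w} e es)
    with W , refl ← strictlySurjective w
    with τ , s , refl ← edge⇒token e =
    let m , f , l = walk⇒message′ refl q es in τ ∷ m , s ∷ f , cong suc l

  walk⇒message : ∀ {n S V} → Walk G n (γ S) (γ V) → ∃[ m ] Effective S m V × length m ≡ n
  walk⇒message = walk⇒message′ refl refl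

  Distance⇒δ : ∀ {S V n} → Distance G (γ S) (γ V) n → δ S V n
  Distance⇒δ (w , min) = walk⇒message w , λ e → min (message⇒walk e)

  δ⇒Distance : ∀ {S V n} → δ S V n → Distance G (γ S) (γ V) n
  δ⇒Distance ((m , e , refl) , min) = message⇒walk e , λ w →
    let _ , f , l = walk⇒message w in ≤-trans (min f) (≤-reflexive l)

  connected : Connected G
  connected u v
    with S , refl ← strictlySurjective u
    with V , refl ← strictlySurjective v =
    let m , e , _ = concise-message S V in length m , message⇒walk e

  _++ʷ_ : ∀ {k l u v w} → Walk G k u v → Walk G l v w → Walk G (k + l) u w
  []       ++ʷ ws = ws
  (e ∷ es) ++ʷ ws = e ∷ (es ++ʷ ws)

  closed-walk-even : ∀ {n u} → Walk G n u u → odd n ≡ false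
  closed-walk-even {u = u} w with S , refl ← strictlySurjective u
    with m , e , refl ← walk⇒message w = return-even e

  -- A vertex is coloured by the parity of a chosen walk from `base`. A single walk `y` from `v`
  -- back to `base` closes up both chosen walks, so `a + suc c` and `b + c` are even and `a`, `b`
  -- differ in parity.
  bipartite : Bipartite G
  bipartite = side , λ {u} {v} u~v →
    let a , w = connected base u
        b , x = connected base v
        c , y = connected v base
    in distinct (odd a) (odd b) (odd c)
         (trans (sym (odd-+ a (suc c))) (closed-walk-even (w ++ʷ (u~v ∷ y))))
         (trans (sym (odd-+ b c)) (closed-walk-even (x ++ʷ y)))
    where
    base : Vertex
    base = γ (proj₁ two-states)

    side : Vertex → Bool
    side v = odd (proj₁ (connected base v))

    distinct : ∀ x y z → x xor not z ≡ false → y xor z ≡ false → x ≢ y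
    distinct false false false () _ _
    distinct false false true  _ () _
    distinct true  true  false _ () _
    distinct true  true  true  () _ _

  like-transitive : Transitive (Like G)
  like-transitive
    {record { source = s ; target = t ; edge = st }}
    {record { source = p ; target = q ; edge = pq }}
    {record { source = x ; target = y ; edge = xy }}
    (n , sp , tq , sq , tp) (n′ , px , qy , py , qx)
    with S , refl ← strictlySurjective s
    with T , refl ← strictlySurjective t
    with P , refl ← strictlySurjective p
    with Q , refl ← strictlySurjective q
    with X , refl ← strictlySurjective x
    with Y , refl ← strictlySurjective y
    with τ , (τ∈𝒯 , τS≢S) , refl ← edge⇒token st
    -- The second and third edges are read backwards, which turns P into `σ Q` and X into `ρ Y`, the
    -- form taken by `like-token`.
    with σ , (σ∈𝒯 , σQ≢Q) , refl ← edge⇒token (~-sym pq)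
    with ρ , (ρ∈𝒯 , ρY≢Y) , refl ← edge⇒token (~-sym xy)
    with τP≡Q ← like-token τ∈𝒯 τS≢S σ∈𝒯 σQ≢Q
           (Distance⇒δ sp) (Distance⇒δ tq) (Distance⇒δ sq) (Distance⇒δ tp)
    -- Since `τ` also effects the middle arc, it can play the part of that arc's token in the second
    -- likeness.
    with τX≡Y ← like-token τ∈𝒯 (λ τP≡P → σQ≢Q (trans (sym τP≡P) τP≡Q)) ρ∈𝒯 ρY≢Y
           (Distance⇒δ px)
           (subst (λ Z → δ Z Y n′) (sym τP≡Q) (Distance⇒δ qy))
           (Distance⇒δ py)
           (subst (λ Z → δ Z (ρ Y) (suc n′)) (sym τP≡Q) (Distance⇒δ qx))
    with k , SX , TY , SY , TX ← token-like τ∈𝒯 τS≢S (λ τX≡X → ρY≢Y (trans (sym τX≡X) τX≡Y)) =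
    k , δ⇒Distance SX
      , δ⇒Distance (subst (λ Z → δ (τ S) Z k) τX≡Y TY)
      , δ⇒Distance (subst (λ Z → δ S Z (suc k)) τX≡Y SY)
      , δ⇒Distance TX

theorem28 : ∀ {ℓ} → ExcludedMiddle ℓ →
    (M : TokenSystem ℓ) → IsMedium M →
    (G : Graph ℓ) → Represents G M → Mediatic G
theorem28 em M isMedium G represents = record
  { connected       = connected
  ; bipartite       = bipartite
  ; like-transitive = λ {a b c} → like-transitive {a} {b} {c}
  }
  where open Representation em M isMedium G represents
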